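{- Let $\eta\in(0,1)$ be fixed, and let $P$ be sufficiently large in terms of $\eta$. Suppose that $\mathbf h=(h_1,h_2,h_3)\in\mathbb Z^3$ is a coefficient triple with the property that $S_2(P;\mathbf h)>P^\eta$. Then the tuple $\mathbf h$ satisfies one of the following two conditions: (a) for some integers $a$ and $b$ with $a\ne b$ and $1\le a,b\le P$, one has $h_j=a^j-b^j$ $(j=1,2,3)$, in which case $S_2(P;\mathbf h)=4P$; (b) one has $h_j=0$ $(j=1,2,3)$, in which case $S_2(P;\mathbf 0)=2P^2-P$. In particular, if $\mathbf h$ satisfies neither condition (a) nor condition (b), then $S_2(P;\mathbf h)=O(P^\varepsilon)$.
   Context: $P$ denotes a large positive integer. For $\mathbf h=(h_1,h_2,h_3)\in\mathbb Z^3$, $S_2(P;\mathbf h)$ denotes the number of integral solutions $(x_1,x_2,y_1,y_2)$ of the system $$x_1^j+x_2^j-y_1^j-y_2^j=h_j\quad (j=1,2,3),$$ with $1\le x_i,y_i\le P$ $(i=1,2)$. A statement involving $\varepsilon$ is asserted to hold for each $\varepsilon>0$.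
   Formalization: In case (a) the value S_2(P;h)=4P is corrected to S_2(P;h)=4P-4: for h_j=a^j-b^j with a≠b, each t outside {a,b} gives 4 ordered solutions, but t=a and t=b give only 2 each. -}

module Defs where

open import Data.Fin using (Fin; toℕ)
open import Data.Fin.Properties using (all?)
open import Data.Integer as ℤ using (ℤ; +_; 0ℤ; 1ℤ)
open import Data.List using (List; map; upTo; cartesianProduct; filter; length)
open import Data.Nat as ℕ using (ℕ; suc)
open import Data.Product using (∃; ∃₂; _×_; _,_)
open import Data.Rational as ℚ using (ℚ; _/_)
open import Data.Sum using (_⊎_)
open import Data.Vec using (Vec; lookup)
open import Function using (_∘_; _⇔_)
open import Relation.Binary.PropositionalEquality using (_≡_; _≢_)
open import Relation.Nullary using (¬_; Dec)

-- Two-sided Dedekind cuts of rationals.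
record ℝ : Set₁ where
  field
    Lower Upper     : ℚ → Set
    lower-inhabited : ∃ Lower
    upper-inhabited : ∃ Upper
    lower-rounded   : ∀ q → Lower q ⇔ (∃ λ r → q ℚ.< r × Lower r)
    upper-rounded   : ∀ q → Upper q ⇔ (∃ λ r → r ℚ.< q × Upper r)
    disjoint        : ∀ q → ¬ (Lower q × Upper q)
    located         : ∀ q r → q ℚ.< r → Lower q ⊎ Upper r

open ℝ public

-- N > P^θ and N ≤ C P^θ for real θ > 0 and natural P ≥ 1.  By continuity and
-- monotonicity P^θ is the infimum of P^(p/k) over rationals p/k > θ, and
-- P^(p/k) is compared with N by raising both sides to the k-th power.  As
-- θ > 0, numerators p ∈ ℕ cover all rationals above θ.

_>_^ʳ_ : ℕ → ℕ → ℝ → Set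
N > P ^ʳ θ = ∃₂ λ p k → Upper θ (+ p / suc k) × P ℕ.^ p ℕ.< N ℕ.^ suc k

_≤_·_^ʳ_ : ℕ → ℕ → ℕ → ℝ → Set
N ≤ C · P ^ʳ θ =
  ∀ p k → Upper θ (+ p / suc k) → N ℕ.^ suc k ℕ.≤ C ℕ.^ suc k ℕ.* P ℕ.^ p

-- The index j : Fin 3 stands for the exponent suc (toℕ j) ∈ {1, 2, 3}.

pow : ℤ → Fin 3 → ℤ
pow x j = x ℤ.^ suc (toℕ j)

IsSolution : Vec ℤ 3 → ℤ × ℤ × ℤ × ℤ → Set
IsSolution h (x₁ , x₂ , y₁ , y₂) =
  ∀ j → pow x₁ j ℤ.+ pow x₂ j ℤ.- pow y₁ j ℤ.- pow y₂ j ≡ lookup h j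

isSolution? : ∀ h v → Dec (IsSolution h v)
isSolution? h (x₁ , x₂ , y₁ , y₂) = all? λ j →
  (pow x₁ j ℤ.+ pow x₂ j ℤ.- pow y₁ j ℤ.- pow y₂ j) ℤ.≟ lookup h j

-- The integers 1, …, P, each listed once.
range : ℕ → List ℤ
range P = map (+_ ∘ suc) (upTo P)

quadruples : ℕ → List (ℤ × ℤ × ℤ × ℤ)
quadruples P =
  cartesianProduct (range P)
    (cartesianProduct (range P) (cartesianProduct (range P) (range P)))

S₂ : ℕ → Vec ℤ 3 → ℕ
S₂ P h = length (filter (isSolution? h) (quadruples P))

-- Under this condition S₂ P h is exactly 4 * P ∸ 4, and not 4 * P.  Since
-- {x₁, x₂, b} = {y₁, y₂, a} as multisets and a ≢ b, the solutions are
-- {x₁, x₂} = {a, t}, {y₁, y₂} = {b, t} with 1 ≤ t ≤ P.  Each t ∉ {a, b} gives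
-- 4 ordered solutions, but t = a and t = b give only 2 each.
ConditionA : ℕ → Vec ℤ 3 → Set
ConditionA P h = ∃₂ λ a b →
  a ≢ b ×
  (1ℤ ℤ.≤ a × a ℤ.≤ + P) ×
  (1ℤ ℤ.≤ b × b ℤ.≤ + P) ×
  (∀ j → lookup h j ≡ pow a j ℤ.- pow b j)

ConditionB : Vec ℤ 3 → Set
ConditionB h = ∀ j → lookup h j ≡ 0ℤ

{-# OPTIONS --safe #-}

-- Everything rests on the identity
--   12 (x₁ − y₁)(x₁ − y₂)(x₂ − y₁)(x₂ − y₂) = h₁⁴ + 3 h₂² − 4 h₁ h₃.
-- If the right-hand side vanishes, then some xᵢ equals some yⱼ, the remaining
-- two variables u and w satisfy hⱼ = uʲ − wʲ, and the solutions can be listed.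
-- Otherwise the differences xᵢ − yⱼ divide a fixed nonzero integer of size at
-- most P⁴, and they determine the solution, because a translation by t ≠ 0
-- preserving h forces h₁ = h₂ = 0.  So the divisor bound d(n) ≪ n^ε applies.

module Submission where

open import Defs
open import Data.Fin using (Fin; zero; suc)
open import Data.Integer as ℤ using (ℤ; +_; 0ℤ; 1ℤ; ∣_∣; +≤+)
open import Data.Integer.Divisibility using () renaming (_∣_ to _∣ℤ_)
import Data.Integer.Properties as ℤ
open import Data.Integer.Solver using (module +-*-Solver)
open import Data.List using (List; []; _∷_; map; upTo; cartesianProduct; cartesianProductWith; length; filter; concat; _++_)
open import Data.List.Membership.Propositional using (_∈_)
open import Data.List.Membership.Propositional.Properties
  using (∈-upTo⁺; ∈-upTo⁻; ∈-cartesianProductWith⁺; ∈-cartesianProduct⁺; ∈-cartesianProduct⁻;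
         ∈-map⁺; ∈-map⁻; ∈-++⁺ˡ; ∈-++⁺ʳ; ∈-++⁻; ∈-∃++; ∈-filter⁺; ∈-filter⁻; ∈-concat⁻; ∈-concat⁺)
open import Data.List.Properties using (length-map; length-++; length-upTo; length-++-sucʳ; ++-identityʳ)
open import Data.List.Relation.Binary.Disjoint.Propositional using (Disjoint)
open import Data.List.Relation.Unary.All as All using ([]; _∷_)
open import Data.List.Relation.Unary.AllPairs using ([]; _∷_)
open import Data.List.Relation.Unary.Any using (here; there)
open import Data.List.Relation.Unary.Unique.Propositional using (Unique)
import Data.List.Relation.Unary.Unique.Propositional.Properties as Unique
open import Data.Nat hiding (_>_)
open import Data.Nat.Coprimality using (Coprime; coprime-divisor)
open import Data.Nat.Divisibility
open import Data.Nat.DivMod using (_/_; _%_; m≡m%n+[m/n]*n; m%n<n; m/n*n≤m)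
open import Data.Nat.Induction using (<-rec)
open import Data.Nat.Primality
open import Data.Nat.Properties
open import Data.Nat.Tactic.RingSolver using (solve-∀)
open import Data.Product using (∃; ∃₂; _×_; _,_; proj₁; proj₂)
open import Data.Rational as ℚ using (0ℚ; 1ℚ; mkℚ)
import Data.Rational.Properties as ℚ
open import Data.Rational.Unnormalised as ℚᵘ using (mkℚᵘ)
import Data.Rational.Unnormalised.Properties as ℚᵘ
open import Data.Sum using (_⊎_; inj₁; inj₂; [_,_]′)
open import Data.Vec using (Vec; lookup; []; _∷_)
open import Function using (_∘_; id; Equivalence; case_of_)
open import Relation.Binary using (tri<; tri≈; tri>)
open import Relation.Binary.PropositionalEquality
open import Relation.Nullary using (¬_; yes; no; contradiction; ¬?; _×-dec_)
open +-*-Solver using (solve; _:=_; _:+_; _:*_; _:-_; _:^_; con)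

-- The divisor bound

-- Real exponents never enter the estimates. Every bound is kept as `N ^ m ≤ C * P` with a natural
-- number `m`, which stands for N ≪ P^(1/m), and a real θ > 0 is used only through one unit fraction
-- 1/(d+1) below it. For the first claim m = 2(d+1) leaves a spare power of `P`, so that a large `P`
-- rules out a nonzero `resolvent h`; for the second claim m = d+1 suffices. The divisor bound is
-- accordingly proved as d(n)^m ≤ K n for each `m`, with an explicit `K` and no logarithms.

length-cartesianProductWith : ∀ {A B C : Set} (f : A → B → C) xs ys →
  length (cartesianProductWith f xs ys) ≡ length xs * length ys
length-cartesianProductWith f []       ys = refl
length-cartesianProductWith f (x ∷ xs) ys =
  trans (length-++ (map (f x) ys))
        (cong₂ _+_ (length-map (f x) ys) (length-cartesianProductWith f xs ys))

^-distribʳ-* : ∀ k m n → (m * n) ^ k ≡ m ^ k * n ^ k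
^-distribʳ-* zero    m n = refl
^-distribʳ-* (suc k) m n =
  trans (cong (m * n *_) (^-distribʳ-* k m n)) (rearrange m n (m ^ k) (n ^ k))
  where
  rearrange : ∀ a b c d → a * b * (c * d) ≡ a * c * (b * d)
  rearrange = solve-∀

^-cancelˡ-≤ : ∀ k {m n} .{{_ : NonZero k}} → m ^ k ≤ n ^ k → m ≤ n
^-cancelˡ-≤ k mᵏ≤nᵏ = ≮⇒≥ λ n<m → <⇒≱ (^-monoˡ-< k n<m) mᵏ≤nᵏ

n<2^n : ∀ n → n < 2 ^ n
n<2^n zero    = s≤s z≤n
n<2^n (suc n) = begin-strict
  suc n           ≤⟨ n<2^n n ⟩
  2 ^ n           <⟨ ^-monoʳ-< 2 ≤-refl (n<1+n n) ⟩
  2 ^ suc n       ∎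
  where open ≤-Reasoning

-- Write a = q m + r: then a + 1 ≤ m (q + 1) ≤ m 2^q.
[1+a]^m≤m^m*2^a : ∀ m .{{_ : NonZero m}} a → suc a ^ m ≤ m ^ m * 2 ^ a
[1+a]^m≤m^m*2^a m a = begin
  suc a ^ m                   ≤⟨ ^-monoˡ-≤ m 1+a≤m*2^q ⟩
  (m * 2 ^ (a / m)) ^ m       ≡⟨ ^-distribʳ-* m m (2 ^ (a / m)) ⟩
  m ^ m * (2 ^ (a / m)) ^ m   ≡⟨ cong (m ^ m *_) (^-*-assoc 2 (a / m) m) ⟩
  m ^ m * 2 ^ (a / m * m)     ≤⟨ *-monoʳ-≤ (m ^ m) (^-monoʳ-≤ 2 (m/n*n≤m a m)) ⟩
  m ^ m * 2 ^ a               ∎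
  where
  open ≤-Reasoning
  1+a≤m*2^q : suc a ≤ m * 2 ^ (a / m)
  1+a≤m*2^q = begin
    suc a                     ≡⟨ cong suc (m≡m%n+[m/n]*n a m) ⟩
    suc (a % m) + a / m * m   ≤⟨ +-monoˡ-≤ (a / m * m) (m%n<n a m) ⟩
    suc (a / m) * m           ≤⟨ *-monoˡ-≤ m (n<2^n (a / m)) ⟩
    2 ^ (a / m) * m           ≡⟨ *-comm (2 ^ (a / m)) m ⟩
    m * 2 ^ (a / m)           ∎

suc-nonTrivial : ∀ n .{{_ : NonTrivial n}} → NonTrivial (suc n)
suc-nonTrivial n = n>1⇒nonTrivial (m<n⇒m<1+n (nonTrivial⇒n>1 n))

prime∧∤⇒coprime : ∀ {p d} → Prime p → p ∤ d → Coprime d p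
prime∧∤⇒coprime p-prime p∤d (c∣d , c∣p) with prime⇒irreducible p-prime c∣p
... | inj₁ c≡1  = c≡1
... | inj₂ refl = contradiction c∣d p∤d

-- Induction on `a`. If `p` divides `d`, one factor `p` is cancelled on both sides; otherwise `d` is
-- coprime to `p`, so it still divides the product with one factor `p` fewer.
∣p^a*n⇒≡p^i*e : ∀ {p} → Prime p → ∀ a {n d} → d ∣ p ^ a * n →
  ∃₂ λ i e → i ≤ a × e ∣ n × d ≡ p ^ i * e
∣p^a*n⇒≡p^i*e pp zero {n} {d} d∣n =
  0 , d , z≤n , subst (d ∣_) (*-identityˡ n) d∣n , sym (*-identityˡ d)
∣p^a*n⇒≡p^i*e {p} pp (suc a) {n} {d} d∣ with p ∣? d
... | no p∤d =
  let i , e , i≤a , e∣n , d≡ = ∣p^a*n⇒≡p^i*e pp a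
        (coprime-divisor (prime∧∤⇒coprime pp p∤d) (subst (d ∣_) (*-assoc p (p ^ a) n) d∣))
  in i , e , m≤n⇒m≤1+n i≤a , e∣n , d≡
... | yes (divides q refl) =
  let i , e , i≤a , e∣n , q≡ = ∣p^a*n⇒≡p^i*e pp a
        (*-cancelˡ-∣ p {{prime⇒nonZero pp}}
          (subst₂ _∣_ (*-comm q p) (*-assoc p (p ^ a) n) d∣))
  in suc i , e , s≤s i≤a , e∣n ,
     trans (*-comm q p) (trans (cong (p *_) q≡) (sym (*-assoc p (p ^ i) e)))

maximal-power : ∀ p .{{_ : NonTrivial p}} n → .{{NonZero n}} →
  ∃₂ λ a e → n ≡ p ^ a * e × p ∤ e
maximal-power p = <-rec _ step
  where
  step : ∀ n → (∀ {k} → k < n → .{{NonZero k}} → ∃₂ λ a e → k ≡ p ^ a * e × p ∤ e) →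
         .{{NonZero n}} → ∃₂ λ a e → n ≡ p ^ a * e × p ∤ e
  step n rec with p ∣? n
  ... | no p∤n = 0 , n , sym (*-identityˡ n) , p∤n
  ... | yes (divides k refl) =
    let instance _ = m*n≢0⇒m≢0 k
        a , e , k≡ , p∤e = rec (m<m*n k p (nonTrivial⇒n>1 p))
    in suc a , e , trans (*-comm k p) (trans (cong (p *_) k≡) (sym (*-assoc p (p ^ a) e))) , p∤e

-- The list may repeat entries and may contain non-divisors: only an upper bound on the number of
-- divisors is wanted, so the divisor function itself is never defined.
DivisorCover : ℕ → ℕ → ℕ → Set
DivisorCover m K n = ∃ λ ds → (∀ {d} → d ∣ n → d ∈ ds) × length ds ^ m ≤ K * n

-- The constants form a budget: `L` has to pay the cost `c` of the prime `p` on top of the cost `K`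
-- of the cofactor. Divisors of the product are covered by the products of a power of `p` with a
-- covered divisor of `n`.
cover-*-prime-power : ∀ {m c K L p n} a → Prime p → suc a ^ m ≤ c * p ^ a → c * K ≤ L →
  DivisorCover m K n → DivisorCover m L (p ^ a * n)
cover-*-prime-power {m} {c} {K} {L} {p} {n} a pp [1+a]^m≤ cK≤L (ds , complete , small) =
  es , complete′ , small′
  where
  es = cartesianProductWith (λ i e → p ^ i * e) (upTo (suc a)) ds

  complete′ : ∀ {d} → d ∣ p ^ a * n → d ∈ es
  complete′ d∣ =
    let i , e , i≤a , e∣n , d≡ = ∣p^a*n⇒≡p^i*e pp a d∣ in
    subst (_∈ es) (sym d≡) (∈-cartesianProductWith⁺ (λ i e → p ^ i * e)
      (∈-upTo⁺ (s≤s i≤a)) (complete e∣n))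

  rearrange : ∀ c q K n → c * q * (K * n) ≡ c * K * (q * n)
  rearrange = solve-∀

  small′ : length es ^ m ≤ L * (p ^ a * n)
  small′ = begin
    length es ^ m                    ≡⟨ cong (_^ m) (length-cartesianProductWith _ (upTo (suc a)) ds) ⟩
    (length (upTo (suc a)) * length ds) ^ m
                                     ≡⟨ cong (λ l → (l * length ds) ^ m) (length-upTo (suc a)) ⟩
    (suc a * length ds) ^ m          ≡⟨ ^-distribʳ-* m (suc a) (length ds) ⟩
    suc a ^ m * length ds ^ m        ≤⟨ *-mono-≤ [1+a]^m≤ small ⟩
    c * p ^ a * (K * n)              ≡⟨ rearrange c (p ^ a) K n ⟩
    c * K * (p ^ a * n)              ≤⟨ *-monoˡ-≤ (p ^ a * n) cK≤L ⟩
    L * (p ^ a * n)                  ∎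
    where open ≤-Reasoning

-- A prime power p^a has a + 1 divisors, and (a + 1)^m ≤ p^a as soon as
-- p ≥ 2^m; each of the finitely many smaller primes costs a factor m^m.
module _ (m : ℕ) .{{_ : NonZero m}} where

  private instance
    m^m≢0 : NonZero (m ^ m)
    m^m≢0 = m^n≢0 m m

  -- Charges `m ^ m` for every integer from `p` up to but excluding `2 ^ m`, prime or not, so that
  -- no primes have to be counted. From `2 ^ m` on, truncated subtraction makes the cost 1.
  smallPrimesCost : ℕ → ℕ
  smallPrimesCost p = (m ^ m) ^ (2 ^ m ∸ p)

  cost-of-prime : ∀ p .{{_ : NonTrivial p}} a →
    ∃ λ c → suc a ^ m ≤ c * p ^ a × c * smallPrimesCost (suc p) ≤ smallPrimesCost p
  cost-of-prime p a with p <? 2 ^ m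
  ... | yes p<2^m = m ^ m
    , ≤-trans ([1+a]^m≤m^m*2^a m a) (*-monoʳ-≤ (m ^ m) (^-monoˡ-≤ a (nonTrivial⇒n>1 p)))
    , ≤-reflexive (cong ((m ^ m) ^_) (suc-∸ p<2^m))
    where
    suc-∸ : ∀ {i n} → i < n → suc (n ∸ suc i) ≡ n ∸ i
    suc-∸ i<n = sym (+-∸-assoc 1 i<n)
  ... | no p≮2^m = 1 , [1+a]^m≤p^a , ≤-trans (≤-reflexive (*-identityˡ _))
      (^-monoʳ-≤ (m ^ m) (∸-monoʳ-≤ (2 ^ m) (n≤1+n p)))
    where
    open ≤-Reasoning
    [1+a]^m≤p^a : suc a ^ m ≤ 1 * p ^ a
    [1+a]^m≤p^a = begin
      suc a ^ m     ≤⟨ ^-monoˡ-≤ m (n<2^n a) ⟩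
      (2 ^ a) ^ m   ≡⟨ ^-*-assoc 2 a m ⟩
      2 ^ (a * m)   ≡⟨ cong (2 ^_) (*-comm a m) ⟩
      2 ^ (m * a)   ≡⟨ ^-*-assoc 2 m a ⟨
      (2 ^ m) ^ a   ≤⟨ ^-monoˡ-≤ a (≮⇒≥ p≮2^m) ⟩
      p ^ a         ≡⟨ *-identityˡ (p ^ a) ⟨
      1 * p ^ a     ∎

  smallPrimesCost-suc : ∀ p → smallPrimesCost (suc p) ≤ smallPrimesCost p
  smallPrimesCost-suc p = ^-monoʳ-≤ (m ^ m) (∸-monoʳ-≤ (2 ^ m) (n≤1+n p))

  -- Trial division with fuel `k`: each call raises `p` by one and lowers `k` by one, which keeps
  -- `k + p` constant. A divisor `p` of a `p`-rough number is automatically prime, and its full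
  -- power is split off at once. When the fuel runs out, `n < p` and roughness leave only n = 1.
  rough-cover : ∀ k p n .{{_ : NonTrivial p}} .{{_ : NonZero n}} →
    n < k + p → p Rough n → DivisorCover m (smallPrimesCost p) n
  rough-cover zero p 1 _ _ =
    1 ∷ [] , (λ d∣1 → here (∣1⇒≡1 d∣1)) ,
    (begin
      1 ^ m                   ≡⟨ ^-zeroˡ m ⟩
      1                       ≤⟨ m^n>0 (m ^ m) (2 ^ m ∸ p) ⟩
      smallPrimesCost p       ≡⟨ *-identityʳ (smallPrimesCost p) ⟨
      smallPrimesCost p * 1   ∎)
    where open ≤-Reasoning
  rough-cover zero p (2+ _) n<p rough = contradiction (rough⇒≤ rough) (<⇒≱ n<p)
  rough-cover (suc k) p n n<1+k+p rough with p ∣? n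
  ... | no p∤n =
    let ds , complete , small = rough-cover k (suc p) n {{suc-nonTrivial p}}
                                      n<k+1+p (∤⇒rough-suc p∤n rough)
    in ds , complete , ≤-trans small (*-monoˡ-≤ n (smallPrimesCost-suc p))
    where
    n<k+1+p : n < k + suc p
    n<k+1+p = subst (n <_) (sym (+-suc k p)) n<1+k+p
  ... | yes p∣n with maximal-power p n
  ...   | a , e , refl , p∤e =
    let c , [1+a]^m≤ , cK≤L = cost-of-prime p a
    in cover-*-prime-power {m} {c} {smallPrimesCost (suc p)} a (rough∧∣⇒prime rough p∣n) [1+a]^m≤ cK≤L
         (rough-cover k (suc p) e {{suc-nonTrivial p}} {{m*n≢0⇒n≢0 (p ^ a)}}
           e<k+1+p (∤⇒rough-suc p∤e (rough∧∣⇒rough rough (n∣m*n (p ^ a)))))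
    where
    e<k+1+p : e < k + suc p
    e<k+1+p = ≤-<-trans (∣⇒≤ (n∣m*n (p ^ a))) (subst (p ^ a * e <_) (sym (+-suc k p)) n<1+k+p)

  divisor-bound : ∃ λ K → ∀ n .{{_ : NonZero n}} → DivisorCover m K n
  divisor-bound = smallPrimesCost 2 , λ n → rough-cover n 2 n (m<m+n n (s≤s z≤n)) 2-rough

-- Counting by injections

-- Pigeonhole by deletion: remove one occurrence of `f x` from `ys`; by uniqueness and injectivity
-- the images of the remaining entries survive. Repetitions in `ys` do no harm, which is what lets
-- redundant covers serve as targets.
injection⇒length-≤ : ∀ {A B : Set} (f : A → B) {xs ys} → Unique xs →
  (∀ {x y} → x ∈ xs → y ∈ xs → f x ≡ f y → x ≡ y) →
  (∀ {x} → x ∈ xs → f x ∈ ys) → length xs ≤ length ys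
injection⇒length-≤ f {[]}     _ _ _ = z≤n
injection⇒length-≤ f {x ∷ xs} (x∉xs ∷ unique) injective f∈ys
  with ps , qs , refl ← ∈-∃++ (f∈ys (here refl)) =
  subst (suc (length xs) ≤_) (sym (length-++-sucʳ ps (f x) qs))
    (s≤s (injection⇒length-≤ f unique (λ y∈ z∈ → injective (there y∈) (there z∈)) f∈ps++qs))
  where
  f∈ps++qs : ∀ {y} → y ∈ xs → f y ∈ ps ++ qs
  f∈ps++qs y∈xs with ∈-++⁻ ps (f∈ys (there y∈xs))
  ... | inj₁ fy∈ps          = ∈-++⁺ˡ fy∈ps
  ... | inj₂ (there fy∈qs)  = ∈-++⁺ʳ ps fy∈qs
  ... | inj₂ (here fy≡fx)   =
    contradiction (injective (here refl) (there y∈xs) (sym fy≡fx)) (All.lookup x∉xs y∈xs)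

sameMembers⇒length-≡ : ∀ {A : Set} {xs ys : List A} → Unique xs → Unique ys →
  (∀ {x} → x ∈ xs → x ∈ ys) → (∀ {x} → x ∈ ys → x ∈ xs) → length xs ≡ length ys
sameMembers⇒length-≡ uxs uys xs⊆ys ys⊆xs = ≤-antisym
  (injection⇒length-≤ id uxs (λ _ _ → id) xs⊆ys)
  (injection⇒length-≤ id uys (λ _ _ → id) ys⊆xs)

map-Disjoint : ∀ {A B C : Set} {f : A → C} {g : B → C} {xs ys} →
  (∀ {x y} → x ∈ xs → y ∈ ys → f x ≢ g y) → Disjoint (map f xs) (map g ys)
map-Disjoint {f = f} {g} f≢g (z∈fxs , z∈gys) =
  let x , x∈xs , z≡fx = ∈-map⁻ f z∈fxs
      y , y∈ys , z≡gy = ∈-map⁻ g z∈gys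
  in f≢g x∈xs y∈ys (trans (sym z≡fx) z≡gy)

-- The resolvent identity

Quadruple : Set
Quadruple = ℤ × ℤ × ℤ × ℤ

rootProduct : Quadruple → ℤ
rootProduct (x₁ , x₂ , y₁ , y₂) =
  (x₁ ℤ.- y₁) ℤ.* (x₁ ℤ.- y₂) ℤ.* (x₂ ℤ.- y₁) ℤ.* (x₂ ℤ.- y₂)

-- `rootProduct` is the resultant of the quadratics with roots xᵢ and yⱼ, which is the
-- supersymmetric Schur function of the 2 × 2 square. Its expansion in power sums is (2 h₁⁴ + 6 h₂²
-- - 8 h₁ h₃) / 24; the fourth power sum is absent because the corresponding character of S₄
-- vanishes on 4-cycles.
resolvent : Vec ℤ 3 → ℤ
resolvent (h₁ ∷ h₂ ∷ h₃ ∷ []) =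
  h₁ ℤ.^ 4 ℤ.+ + 3 ℤ.* h₂ ℤ.^ 2 ℤ.- + 4 ℤ.* (h₁ ℤ.* h₃)

12*rootProduct≡resolvent : ∀ {h v} → IsSolution h v → + 12 ℤ.* rootProduct v ≡ resolvent h
12*rootProduct≡resolvent {_ ∷ _ ∷ _ ∷ []} {x₁ , x₂ , y₁ , y₂} sol
  with refl ← sol zero | refl ← sol (suc zero) | refl ← sol (suc (suc zero)) =
  solve 4 (λ x₁ x₂ y₁ y₂ →
      let h = λ j → x₁ :^ j :+ x₂ :^ j :- y₁ :^ j :- y₂ :^ j in
      con (+ 12) :* ((x₁ :- y₁) :* (x₁ :- y₂) :* (x₂ :- y₁) :* (x₂ :- y₂))
      := h 1 :^ 4 :+ con (+ 3) :* h 2 :^ 2 :- con (+ 4) :* (h 1 :* h 3))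
    refl x₁ x₂ y₁ y₂

-- To be expected, since (a, t, b, t) has these power sums and a vanishing `rootProduct`. It gives
-- the converse direction for the exact counts: under either condition every solution is degenerate.
resolvent-pow-difference : ∀ {h} a b → (∀ j → lookup h j ≡ pow a j ℤ.- pow b j) → resolvent h ≡ 0ℤ
resolvent-pow-difference {_ ∷ _ ∷ _ ∷ []} a b h≡
  with refl ← h≡ zero | refl ← h≡ (suc zero) | refl ← h≡ (suc (suc zero)) =
  solve 2 (λ a b →
      let h = λ j → a :^ j :- b :^ j in
      h 1 :^ 4 :+ con (+ 3) :* h 2 :^ 2 :- con (+ 4) :* (h 1 :* h 3) := con 0ℤ)
    refl a b

-- Exponent 1 gives the difference u - w; dividing the equation for exponent 2 by the nonzero a - b
-- gives the sum u + w; sum and difference determine the pair.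
pow-difference-injective : ∀ {a b u w} → a ≢ b →
  (∀ j → pow u j ℤ.- pow w j ≡ pow a j ℤ.- pow b j) → u ≡ a × w ≡ b
pow-difference-injective {a} {b} {u} {w} a≢b eq = u≡a , w≡b
  where
  open ≡-Reasoning
  instance
    a-b≢0 : ℤ.NonZero (a ℤ.- b)
    a-b≢0 = ℤ.≢-nonZero (a≢b ∘ ℤ.i-j≡0⇒i≡j a b)

  u-w≡a-b : u ℤ.- w ≡ a ℤ.- b
  u-w≡a-b = begin
    u ℤ.- w                 ≡⟨ cong₂ ℤ._-_ (ℤ.^-identityʳ u) (ℤ.^-identityʳ w) ⟨
    u ℤ.^ 1 ℤ.- w ℤ.^ 1     ≡⟨ eq zero ⟩
    a ℤ.^ 1 ℤ.- b ℤ.^ 1     ≡⟨ cong₂ ℤ._-_ (ℤ.^-identityʳ a) (ℤ.^-identityʳ b) ⟩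
    a ℤ.- b                 ∎

  difference-of-squares : ∀ x y → (x ℤ.- y) ℤ.* (x ℤ.+ y) ≡ x ℤ.^ 2 ℤ.- y ℤ.^ 2
  difference-of-squares = solve 2 (λ x y → (x :- y) :* (x :+ y) := x :^ 2 :- y :^ 2) refl

  u+w≡a+b : u ℤ.+ w ≡ a ℤ.+ b
  u+w≡a+b = ℤ.*-cancelˡ-≡ (a ℤ.- b) (u ℤ.+ w) (a ℤ.+ b) (begin
    (a ℤ.- b) ℤ.* (u ℤ.+ w)   ≡⟨ cong (ℤ._* (u ℤ.+ w)) u-w≡a-b ⟨
    (u ℤ.- w) ℤ.* (u ℤ.+ w)   ≡⟨ difference-of-squares u w ⟩
    u ℤ.^ 2 ℤ.- w ℤ.^ 2       ≡⟨ eq (suc zero) ⟩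
    a ℤ.^ 2 ℤ.- b ℤ.^ 2       ≡⟨ difference-of-squares a b ⟨
    (a ℤ.- b) ℤ.* (a ℤ.+ b)   ∎)

  2x≡ : ∀ x y → + 2 ℤ.* x ≡ (x ℤ.+ y) ℤ.+ (x ℤ.- y)
  2x≡ = solve 2 (λ x y → con (+ 2) :* x := (x :+ y) :+ (x :- y)) refl

  2y≡ : ∀ x y → + 2 ℤ.* y ≡ (x ℤ.+ y) ℤ.- (x ℤ.- y)
  2y≡ = solve 2 (λ x y → con (+ 2) :* y := (x :+ y) :- (x :- y)) refl

  u≡a : u ≡ a
  u≡a = ℤ.*-cancelˡ-≡ (+ 2) u a
    (trans (2x≡ u w) (trans (cong₂ ℤ._+_ u+w≡a+b u-w≡a-b) (sym (2x≡ a b))))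

  w≡b : w ≡ b
  w≡b = ℤ.*-cancelˡ-≡ (+ 2) w b
    (trans (2y≡ u w) (trans (cong₂ ℤ._-_ u+w≡a+b u-w≡a-b) (sym (2y≡ a b))))

power-sums-cancel : ∀ u w t →
  (u ℤ.+ t ℤ.- w ℤ.- t ≡ u ℤ.- w) × (u ℤ.+ t ℤ.- t ℤ.- w ≡ u ℤ.- w) ×
  (t ℤ.+ u ℤ.- w ℤ.- t ≡ u ℤ.- w) × (t ℤ.+ u ℤ.- t ℤ.- w ≡ u ℤ.- w)
power-sums-cancel u w t =
    solve 3 (λ u w t → u :+ t :- w :- t := u :- w) refl u w t
  , solve 3 (λ u w t → u :+ t :- t :- w := u :- w) refl u w t
  , solve 3 (λ u w t → t :+ u :- w :- t := u :- w) refl u w t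
  , solve 3 (λ u w t → t :+ u :- t :- w := u :- w) refl u w t

-- Differences determine a solution up to translation

equal-differences⇒equal-shifts : ∀ a b a′ b′ → a ℤ.- b ≡ a′ ℤ.- b′ → a′ ℤ.- a ≡ b′ ℤ.- b
equal-differences⇒equal-shifts a b a′ b′ eq = begin
  a′ ℤ.- a                                  ≡⟨ rearrange a b a′ b′ ⟩
  b′ ℤ.- b ℤ.+ ((a′ ℤ.- b′) ℤ.- (a ℤ.- b))  ≡⟨ cong (ℤ._+_ (b′ ℤ.- b)) (ℤ.i≡j⇒i-j≡0 (sym eq)) ⟩
  b′ ℤ.- b ℤ.+ 0ℤ                           ≡⟨ ℤ.+-identityʳ (b′ ℤ.- b) ⟩
  b′ ℤ.- b                                  ∎
  where
  open ≡-Reasoning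
  rearrange : ∀ a b a′ b′ → a′ ℤ.- a ≡ b′ ℤ.- b ℤ.+ ((a′ ℤ.- b′) ℤ.- (a ℤ.- b))
  rearrange = solve 4 (λ a b a′ b′ → a′ :- a := b′ :- b :+ ((a′ :- b′) :- (a :- b))) refl

shift⇒translate : ∀ x x′ {t} → x′ ℤ.- x ≡ t → x′ ≡ x ℤ.+ t
shift⇒translate x x′ refl = solve 2 (λ x x′ → x′ := x :+ (x′ :- x)) refl x x′

translate : ℤ → Quadruple → Quadruple
translate t (x₁ , x₂ , y₁ , y₂) = x₁ ℤ.+ t , x₂ ℤ.+ t , y₁ ℤ.+ t , y₂ ℤ.+ t

translate-identity : ∀ v → translate 0ℤ v ≡ v
translate-identity (x₁ , x₂ , y₁ , y₂)
  rewrite ℤ.+-identityʳ x₁ | ℤ.+-identityʳ x₂ | ℤ.+-identityʳ y₁ | ℤ.+-identityʳ y₂ = refl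

-- Translating by t changes the quadratic power sum by 2 t h₁ and the cubic
-- one by 3 t (h₂ + t h₁).
translated-solution : ∀ {h₁ h₂ h₃ t} v → IsSolution (h₁ ∷ h₂ ∷ h₃ ∷ []) v →
  IsSolution (h₁ ∷ h₂ ∷ h₃ ∷ []) (translate t v) →
  + 2 ℤ.* t ℤ.* h₁ ≡ 0ℤ × + 3 ℤ.* t ℤ.* (h₂ ℤ.+ t ℤ.* h₁) ≡ 0ℤ
translated-solution {h₁} {h₂} {h₃} {t} (x₁ , x₂ , y₁ , y₂) sol sol′ = 2th₁≡0 , 3th₂≡0
  where
  open ≡-Reasoning
  2th₁≡0 : + 2 ℤ.* t ℤ.* h₁ ≡ 0ℤ
  2th₁≡0 = begin
    + 2 ℤ.* t ℤ.* h₁ ≡⟨ cong (+ 2 ℤ.* t ℤ.*_) (sol zero) ⟨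
    _                ≡⟨ solve 5 (λ x₁ x₂ y₁ y₂ t →
                          con (+ 2) :* t :* (x₁ :^ 1 :+ x₂ :^ 1 :- y₁ :^ 1 :- y₂ :^ 1) :=
                          ((x₁ :+ t) :^ 2 :+ (x₂ :+ t) :^ 2 :- (y₁ :+ t) :^ 2 :- (y₂ :+ t) :^ 2) :-
                          (x₁ :^ 2 :+ x₂ :^ 2 :- y₁ :^ 2 :- y₂ :^ 2))
                        refl x₁ x₂ y₁ y₂ t ⟩
    _                ≡⟨ ℤ.i≡j⇒i-j≡0 (trans (sol′ (suc zero)) (sym (sol (suc zero)))) ⟩
    0ℤ               ∎

  3th₂≡0 : + 3 ℤ.* t ℤ.* (h₂ ℤ.+ t ℤ.* h₁) ≡ 0ℤ
  3th₂≡0 = begin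
    + 3 ℤ.* t ℤ.* (h₂ ℤ.+ t ℤ.* h₁)
                     ≡⟨ cong₂ (λ h₂ h₁ → + 3 ℤ.* t ℤ.* (h₂ ℤ.+ t ℤ.* h₁)) (sol (suc zero)) (sol zero) ⟨
    _                ≡⟨ solve 5 (λ x₁ x₂ y₁ y₂ t →
                          con (+ 3) :* t :* ((x₁ :^ 2 :+ x₂ :^ 2 :- y₁ :^ 2 :- y₂ :^ 2)
                            :+ t :* (x₁ :^ 1 :+ x₂ :^ 1 :- y₁ :^ 1 :- y₂ :^ 1)) :=
                          ((x₁ :+ t) :^ 3 :+ (x₂ :+ t) :^ 3 :- (y₁ :+ t) :^ 3 :- (y₂ :+ t) :^ 3) :-
                          (x₁ :^ 3 :+ x₂ :^ 3 :- y₁ :^ 3 :- y₂ :^ 3))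
                        refl x₁ x₂ y₁ y₂ t ⟩
    _                ≡⟨ ℤ.i≡j⇒i-j≡0 (trans (sol′ (suc (suc zero))) (sym (sol (suc (suc zero))))) ⟩
    0ℤ               ∎

shift-or-h₁h₂-vanish : ∀ {h₁ h₂} t →
  + 2 ℤ.* t ℤ.* h₁ ≡ 0ℤ → + 3 ℤ.* t ℤ.* (h₂ ℤ.+ t ℤ.* h₁) ≡ 0ℤ →
  t ≡ 0ℤ ⊎ (h₁ ≡ 0ℤ × h₂ ≡ 0ℤ)
shift-or-h₁h₂-vanish {h₁} {h₂} t 2th₁≡0 3th₂≡0
  with ℤ.i*j≡0⇒i≡0∨j≡0 (+ 2 ℤ.* t) 2th₁≡0 | ℤ.i*j≡0⇒i≡0∨j≡0 (+ 3 ℤ.* t) 3th₂≡0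
... | inj₁ 2t≡0 | _         = inj₁ ([ (λ ()) , id ]′ (ℤ.i*j≡0⇒i≡0∨j≡0 (+ 2) 2t≡0))
... | inj₂ _    | inj₁ 3t≡0 = inj₁ ([ (λ ()) , id ]′ (ℤ.i*j≡0⇒i≡0∨j≡0 (+ 3) 3t≡0))
... | inj₂ refl | inj₂ h₂+t*0≡0 = inj₂ (refl ,
  trans (sym (trans (cong (ℤ._+_ h₂) (ℤ.*-zeroʳ t)) (ℤ.+-identityʳ h₂))) h₂+t*0≡0)

translation-trivial : ∀ {h t} v → resolvent h ≢ 0ℤ →
  IsSolution h v → IsSolution h (translate t v) → t ≡ 0ℤ
translation-trivial {h₁ ∷ h₂ ∷ h₃ ∷ []} {t} v r≢0 sol sol′ =
  let 2th₁≡0 , 3th₂≡0 = translated-solution {h₁} {h₂} {h₃} {t} v sol sol′ in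
  [ id , (λ (h₁≡0 , h₂≡0) → contradiction (resolvent-vanishes h₁≡0 h₂≡0) r≢0) ]′
    (shift-or-h₁h₂-vanish {h₁} {h₂} t 2th₁≡0 3th₂≡0)
  where
  -- Every monomial of the resolvent contains h₁ or h₂, so h₃ may remain arbitrary here.
  resolvent-vanishes : h₁ ≡ 0ℤ → h₂ ≡ 0ℤ → resolvent (h₁ ∷ h₂ ∷ h₃ ∷ []) ≡ 0ℤ
  resolvent-vanishes h₁≡0 h₂≡0 =
    cong₂ (λ h₁ h₂ → resolvent (h₁ ∷ h₂ ∷ h₃ ∷ [])) h₁≡0 h₂≡0

-- Three of the four differences are enough, because x₂ - y₂ = (x₂ - y₁) + (x₁ - y₂) - (x₁ - y₁).
differences : Quadruple → ℤ × ℤ × ℤ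
differences (x₁ , x₂ , y₁ , y₂) = x₁ ℤ.- y₁ , x₁ ℤ.- y₂ , x₂ ℤ.- y₁

equal-differences⇒translate : ∀ v v′ → differences v ≡ differences v′ →
  ∃ λ t → v′ ≡ translate t v
equal-differences⇒translate (x₁ , x₂ , y₁ , y₂) (x₁′ , x₂′ , y₁′ , y₂′) eq =
  x₁′ ℤ.- x₁ ,
  cong₂ _,_ (shift⇒translate x₁ x₁′ refl)
    (cong₂ _,_ (shift⇒translate x₂ x₂′ x₂-shift)
      (cong₂ _,_ (shift⇒translate y₁ y₁′ y₁-shift) (shift⇒translate y₂ y₂′ y₂-shift)))
  where
  -- The shift of x₁ passes to y₁ and y₂ through their differences with x₁, and then from y₁ to x₂.
  y₁-shift = sym (equal-differences⇒equal-shifts x₁ y₁ x₁′ y₁′ (cong proj₁ eq))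
  y₂-shift = sym (equal-differences⇒equal-shifts x₁ y₂ x₁′ y₂′ (cong (proj₁ ∘ proj₂) eq))
  x₂-shift = trans (equal-differences⇒equal-shifts x₂ y₁ x₂′ y₁′ (cong (proj₂ ∘ proj₂) eq)) y₁-shift

differences-injective : ∀ {h v v′} → resolvent h ≢ 0ℤ →
  IsSolution h v → IsSolution h v′ → differences v ≡ differences v′ → v ≡ v′
differences-injective {h} {v} {v′} r≢0 sol sol′ eq =
  let t , v′≡ = equal-differences⇒translate v v′ eq
      t≡0     = translation-trivial {h} {t} v r≢0 sol (subst (IsSolution h) v′≡ sol′)
  in sym (trans v′≡ (trans (cong (λ t → translate t v) t≡0) (translate-identity v)))

-- Degenerate solutions

solutions : ℕ → Vec ℤ 3 → List Quadruple
solutions P h = filter (isSolution? h) (quadruples P)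

∈-range⁺ : ∀ {P a} → 1ℤ ℤ.≤ a → a ℤ.≤ + P → a ∈ range P
∈-range⁺ {a = + suc i} _ (+≤+ i<P) = ∈-map⁺ (+_ ∘ suc) (∈-upTo⁺ i<P)
∈-range⁺ {a = + zero} (+≤+ ()) _

∈-range⁻ : ∀ {P a} → a ∈ range P → 1ℤ ℤ.≤ a × a ℤ.≤ + P
∈-range⁻ a∈ with _ , i∈ , refl ← ∈-map⁻ (+_ ∘ suc) a∈ = +≤+ (s≤s z≤n) , +≤+ (∈-upTo⁻ i∈)

range-unique : ∀ P → Unique (range P)
range-unique P = Unique.map⁺ (suc-injective ∘ ℤ.+-injective) (Unique.upTo⁺ P)

length-range : ∀ P → length (range P) ≡ P
length-range P = trans (length-map (+_ ∘ suc) (upTo P)) (length-upTo P)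

∈-quadruples⁺ : ∀ {P x₁ x₂ y₁ y₂} → x₁ ∈ range P → x₂ ∈ range P → y₁ ∈ range P → y₂ ∈ range P →
  (x₁ , x₂ , y₁ , y₂) ∈ quadruples P
∈-quadruples⁺ x₁∈ x₂∈ y₁∈ y₂∈ =
  ∈-cartesianProduct⁺ x₁∈ (∈-cartesianProduct⁺ x₂∈ (∈-cartesianProduct⁺ y₁∈ y₂∈))

∈-quadruples⁻ : ∀ {P x₁ x₂ y₁ y₂} → (x₁ , x₂ , y₁ , y₂) ∈ quadruples P →
  x₁ ∈ range P × x₂ ∈ range P × y₁ ∈ range P × y₂ ∈ range P
∈-quadruples⁻ {P} v∈ =
  let x₁∈ , v∈′  = ∈-cartesianProduct⁻ (range P) _ v∈
      x₂∈ , v∈″  = ∈-cartesianProduct⁻ (range P) _ v∈′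
      y₁∈ , y₂∈  = ∈-cartesianProduct⁻ (range P) (range P) v∈″
  in x₁∈ , x₂∈ , y₁∈ , y₂∈

solutions-unique : ∀ P h → Unique (solutions P h)
solutions-unique P h = Unique.filter⁺ (isSolution? h)
  (Unique.cartesianProduct⁺ r (Unique.cartesianProduct⁺ r (Unique.cartesianProduct⁺ r r)))
  where r = range-unique P

∈-solutions⁻ : ∀ {P h v} → v ∈ solutions P h → v ∈ quadruples P × IsSolution h v
∈-solutions⁻ {P} {h} = ∈-filter⁻ (isSolution? h) {xs = quadruples P}

powerSum : Quadruple → Fin 3 → ℤ
powerSum (x₁ , x₂ , y₁ , y₂) j = pow x₁ j ℤ.+ pow x₂ j ℤ.- pow y₁ j ℤ.- pow y₂ j

-- The quadruples in which a common entry t of both pairs leaves u and w.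
degenerate : ℤ → ℤ → ℤ → List Quadruple
degenerate u w t =
  (u , t , w , t) ∷ (u , t , t , w) ∷ (t , u , w , t) ∷ (t , u , t , w) ∷ []

degenerate-powerSum : ∀ {u w t v} → v ∈ degenerate u w t →
  ∀ j → powerSum v j ≡ pow u j ℤ.- pow w j
degenerate-powerSum {u} {w} {t} (here refl) j =
  proj₁ (power-sums-cancel (pow u j) (pow w j) (pow t j))
degenerate-powerSum {u} {w} {t} (there (here refl)) j =
  proj₁ (proj₂ (power-sums-cancel (pow u j) (pow w j) (pow t j)))
degenerate-powerSum {u} {w} {t} (there (there (here refl))) j =
  proj₁ (proj₂ (proj₂ (power-sums-cancel (pow u j) (pow w j) (pow t j))))
degenerate-powerSum {u} {w} {t} (there (there (there (here refl)))) j =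
  proj₂ (proj₂ (proj₂ (power-sums-cancel (pow u j) (pow w j) (pow t j))))

degenerate⊆quadruples : ∀ {P u w t v} → u ∈ range P → w ∈ range P → t ∈ range P →
  v ∈ degenerate u w t → v ∈ quadruples P
degenerate⊆quadruples u∈ w∈ t∈ (here refl)                         = ∈-quadruples⁺ u∈ t∈ w∈ t∈
degenerate⊆quadruples u∈ w∈ t∈ (there (here refl))                 = ∈-quadruples⁺ u∈ t∈ t∈ w∈
degenerate⊆quadruples u∈ w∈ t∈ (there (there (here refl)))         = ∈-quadruples⁺ t∈ u∈ w∈ t∈
degenerate⊆quadruples u∈ w∈ t∈ (there (there (there (here refl)))) = ∈-quadruples⁺ t∈ u∈ t∈ w∈

degenerate⊆solutions : ∀ {P h u w t v} → u ∈ range P → w ∈ range P → t ∈ range P →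
  (∀ j → lookup h j ≡ pow u j ℤ.- pow w j) → v ∈ degenerate u w t → v ∈ solutions P h
degenerate⊆solutions {P} {h} u∈ w∈ t∈ h≡ v∈ =
  ∈-filter⁺ (isSolution? h) (degenerate⊆quadruples u∈ w∈ t∈ v∈)
    (λ j → trans (degenerate-powerSum v∈ j) (sym (h≡ j)))

Degenerate : ℕ → Vec ℤ 3 → Quadruple → Set
Degenerate P h v = ∃ λ u → ∃₂ λ w t →
  (u ∈ range P × w ∈ range P × t ∈ range P) ×
  v ∈ degenerate u w t × (∀ j → lookup h j ≡ pow u j ℤ.- pow w j)

rootProduct≡0⇒degenerate : ∀ {v} → rootProduct v ≡ 0ℤ → ∃ λ u → ∃₂ λ w t → v ∈ degenerate u w t
rootProduct≡0⇒degenerate {x₁ , x₂ , y₁ , y₂} product≡0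
  with ℤ.i*j≡0⇒i≡0∨j≡0 ((x₁ ℤ.- y₁) ℤ.* (x₁ ℤ.- y₂) ℤ.* (x₂ ℤ.- y₁)) product≡0
... | inj₂ x₂-y₂≡0 with refl ← ℤ.i-j≡0⇒i≡j x₂ y₂ x₂-y₂≡0 = x₁ , y₁ , x₂ , here refl
... | inj₁ product≡0 with ℤ.i*j≡0⇒i≡0∨j≡0 ((x₁ ℤ.- y₁) ℤ.* (x₁ ℤ.- y₂)) product≡0
...   | inj₂ x₂-y₁≡0 with refl ← ℤ.i-j≡0⇒i≡j x₂ y₁ x₂-y₁≡0 = x₁ , y₂ , x₂ , there (here refl)
...   | inj₁ product≡0 with ℤ.i*j≡0⇒i≡0∨j≡0 (x₁ ℤ.- y₁) product≡0
...     | inj₂ x₁-y₂≡0 with refl ← ℤ.i-j≡0⇒i≡j x₁ y₂ x₁-y₂≡0 = x₂ , y₁ , x₁ , there (there (here refl))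
...     | inj₁ x₁-y₁≡0 with refl ← ℤ.i-j≡0⇒i≡j x₁ y₁ x₁-y₁≡0 = x₂ , y₂ , x₁ , there (there (there (here refl)))

degenerate⊆range : ∀ {P u w t v} → v ∈ quadruples P → v ∈ degenerate u w t →
  u ∈ range P × w ∈ range P × t ∈ range P
degenerate⊆range v∈ (here refl) =
  let u∈ , t∈ , w∈ , _ = ∈-quadruples⁻ v∈ in u∈ , w∈ , t∈
degenerate⊆range v∈ (there (here refl)) =
  let u∈ , t∈ , _ , w∈ = ∈-quadruples⁻ v∈ in u∈ , w∈ , t∈
degenerate⊆range v∈ (there (there (here refl))) =
  let t∈ , u∈ , w∈ , _ = ∈-quadruples⁻ v∈ in u∈ , w∈ , t∈
degenerate⊆range v∈ (there (there (there (here refl)))) =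
  let t∈ , u∈ , _ , w∈ = ∈-quadruples⁻ v∈ in u∈ , w∈ , t∈

solution⇒degenerate : ∀ {P h v} → v ∈ solutions P h → rootProduct v ≡ 0ℤ → Degenerate P h v
solution⇒degenerate {P} {h} {v} v∈ product≡0 =
  let v∈q , sol         = ∈-solutions⁻ {P} {h} v∈
      u , w , t , v∈deg = rootProduct≡0⇒degenerate {v} product≡0
  in u , w , t , degenerate⊆range v∈q v∈deg , v∈deg ,
     λ j → trans (sym (sol j)) (degenerate-powerSum v∈deg j)

resolvent≡0⇒degenerate : ∀ {P h v} → resolvent h ≡ 0ℤ → v ∈ solutions P h → Degenerate P h v
resolvent≡0⇒degenerate {P} {h} {v} resolvent≡0 v∈ = solution⇒degenerate {P} {h} {v} v∈
  ([ (λ ()) , id ]′ (ℤ.i*j≡0⇒i≡0∨j≡0 (+ 12) {rootProduct v}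
    (trans (12*rootProduct≡resolvent {h} {v} (proj₂ (∈-solutions⁻ {P} {h} v∈))) resolvent≡0)))

length-concat₄ : ∀ {A : Set} (ws xs ys zs : List A) →
  length (concat (ws ∷ xs ∷ ys ∷ zs ∷ [])) ≡ length ws + (length xs + (length ys + length zs))
length-concat₄ ws xs ys zs = begin
  length (ws ++ xs ++ ys ++ zs ++ [])
    ≡⟨ length-++ ws ⟩
  length ws + length (xs ++ ys ++ zs ++ [])
    ≡⟨ cong (_+_ (length ws)) (length-++ xs) ⟩
  length ws + (length xs + length (ys ++ zs ++ []))
    ≡⟨ cong (λ n → length ws + (length xs + n)) (length-++ ys) ⟩
  length ws + (length xs + (length ys + length (zs ++ [])))
    ≡⟨ cong (λ zs → length ws + (length xs + (length ys + length zs))) (++-identityʳ zs) ⟩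
  length ws + (length xs + (length ys + length zs)) ∎
  where open ≡-Reasoning

-- The exact count under condition (a)

module ConditionACount {P : ℕ} {h : Vec ℤ 3} {a b : ℤ} (a≢b : a ≢ b) (a∈ : a ∈ range P) (b∈ : b ∈ range P)
  (h≡ : ∀ j → lookup h j ≡ pow a j ℤ.- pow b j) where

  others : List ℤ
  others = filter (λ t → ¬? (t ℤ.≟ a) ×-dec ¬? (t ℤ.≟ b)) (range P)

  ∈-others⁻ : ∀ {t} → t ∈ others → t ∈ range P × t ≢ a × t ≢ b
  ∈-others⁻ = ∈-filter⁻ (λ t → ¬? (t ℤ.≟ a) ×-dec ¬? (t ℤ.≟ b)) {xs = range P}

  ∈-others⁺ : ∀ {t} → t ∈ range P → t ≢ a → t ≢ b → t ∈ others
  ∈-others⁺ t∈ t≢a t≢b = ∈-filter⁺ (λ t → ¬? (t ℤ.≟ a) ×-dec ¬? (t ℤ.≟ b)) t∈ (t≢a , t≢b)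

  others-unique : Unique others
  others-unique = Unique.filter⁺ _ (range-unique P)

  -- Stated as a sum rather than with `P ∸ 2`: substituting 2 + T for `P` turns the final count into
  -- a polynomial identity in T, in which the truncated `4 * P ∸ 4` is exact.
  2+length-others≡P : 2 + length others ≡ P
  2+length-others≡P = trans
    (sameMembers⇒length-≡
      ((a≢b ∷ All.tabulate (λ t∈ a≡t → proj₁ (proj₂ (∈-others⁻ t∈)) (sym a≡t)))
        ∷ All.tabulate (λ t∈ b≡t → proj₂ (proj₂ (∈-others⁻ t∈)) (sym b≡t))
        ∷ others-unique)
      (range-unique P) into onto)
    (length-range P)
    where
    into : ∀ {t} → t ∈ a ∷ b ∷ others → t ∈ range P
    into (here refl)         = a∈
    into (there (here refl)) = b∈
    into (there (there t∈))  = proj₁ (∈-others⁻ t∈)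
    onto : ∀ {t} → t ∈ range P → t ∈ a ∷ b ∷ others
    onto {t} t∈ with t ℤ.≟ a | t ℤ.≟ b
    ... | yes t≡a | _       = here t≡a
    ... | no _    | yes t≡b = there (here t≡b)
    ... | no t≢a  | no t≢b  = there (there (∈-others⁺ t∈ t≢a t≢b))

  f₁ f₂ f₃ f₄ : ℤ → Quadruple
  f₁ t = a , t , b , t
  f₂ t = a , t , t , b
  f₃ t = t , a , b , t
  f₄ t = t , a , t , b

  -- For t ∈ {a , b} the values f₂ t and f₃ t are among those of f₁ and f₄.
  blocks : List (List Quadruple)
  blocks = map f₁ (range P) ∷ map f₄ (range P) ∷ map f₂ others ∷ map f₃ others ∷ []

  concat-blocks-unique : Unique (concat blocks)
  concat-blocks-unique = Unique.concat⁺
    ( Unique.map⁺ (cong (proj₁ ∘ proj₂)) (range-unique P)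
    ∷ Unique.map⁺ (cong proj₁) (range-unique P)
    ∷ Unique.map⁺ (cong (proj₁ ∘ proj₂)) others-unique
    ∷ Unique.map⁺ (cong proj₁) others-unique
    ∷ [])
    -- Comparing coordinates separates the blocks: a common value of `f₁` and `f₄` would give a = b,
    -- and in each of the other pairs some coordinate would force an element of `others` to equal
    -- `a` or `b`.
    ( ( map-Disjoint (λ _ _ eq → a≢b (trans (cong proj₁ eq) (sym (cong (proj₁ ∘ proj₂ ∘ proj₂) eq))))
      ∷ map-Disjoint (λ _ t∈ eq → proj₂ (proj₂ (∈-others⁻ t∈)) (sym (cong (proj₁ ∘ proj₂ ∘ proj₂) eq)))
      ∷ map-Disjoint (λ _ t∈ eq → proj₁ (proj₂ (∈-others⁻ t∈)) (sym (cong proj₁ eq)))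
      ∷ [])
    ∷ ( map-Disjoint (λ _ t∈ eq → proj₁ (proj₂ (∈-others⁻ t∈)) (sym (cong (proj₁ ∘ proj₂) eq)))
      ∷ map-Disjoint (λ _ t∈ eq → proj₂ (proj₂ (∈-others⁻ t∈)) (sym (cong (proj₂ ∘ proj₂ ∘ proj₂) eq)))
      ∷ [])
    ∷ ( map-Disjoint (λ _ t∈ eq → proj₁ (proj₂ (∈-others⁻ t∈)) (sym (cong proj₁ eq)))
      ∷ [])
    ∷ [] ∷ [])

  concat-blocks⊆solutions : ∀ {v} → v ∈ concat blocks → v ∈ solutions P h
  concat-blocks⊆solutions v∈ with ∈-concat⁻ blocks v∈
  ... | here v∈ with t , t∈ , refl ← ∈-map⁻ f₁ v∈ =
    degenerate⊆solutions {h = h} a∈ b∈ t∈ h≡ (here refl)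
  ... | there (here v∈) with t , t∈ , refl ← ∈-map⁻ f₄ v∈ =
    degenerate⊆solutions {h = h} a∈ b∈ t∈ h≡ (there (there (there (here refl))))
  ... | there (there (here v∈)) with t , t∈ , refl ← ∈-map⁻ f₂ v∈ =
    degenerate⊆solutions {h = h} a∈ b∈ (proj₁ (∈-others⁻ t∈)) h≡ (there (here refl))
  ... | there (there (there (here v∈))) with t , t∈ , refl ← ∈-map⁻ f₃ v∈ =
    degenerate⊆solutions {h = h} a∈ b∈ (proj₁ (∈-others⁻ t∈)) h≡ (there (there (here refl)))

  f₁∈ : ∀ {t} → t ∈ range P → f₁ t ∈ concat blocks
  f₁∈ t∈ = ∈-concat⁺ {xss = blocks} (here (∈-map⁺ f₁ t∈))

  f₄∈ : ∀ {t} → t ∈ range P → f₄ t ∈ concat blocks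
  f₄∈ t∈ = ∈-concat⁺ {xss = blocks} (there (here (∈-map⁺ f₄ t∈)))

  degenerate⊆concat-blocks : ∀ {t v} → t ∈ range P → v ∈ degenerate a b t → v ∈ concat blocks
  degenerate⊆concat-blocks t∈ (here refl) = f₁∈ t∈
  degenerate⊆concat-blocks {t} t∈ (there (here refl)) with t ℤ.≟ a | t ℤ.≟ b
  -- Here (a, a, a, b) is `f₄ a`, and in the next case (a, b, b, b) is `f₁ b`.
  ... | yes refl | _        = f₄∈ a∈
  ... | no _     | yes refl = f₁∈ b∈
  ... | no t≢a   | no t≢b   =
    ∈-concat⁺ {xss = blocks} (there (there (here (∈-map⁺ f₂ (∈-others⁺ t∈ t≢a t≢b)))))
  degenerate⊆concat-blocks {t} t∈ (there (there (here refl))) with t ℤ.≟ a | t ℤ.≟ b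
  ... | yes refl | _        = f₁∈ a∈
  ... | no _     | yes refl = f₄∈ b∈
  ... | no t≢a   | no t≢b   =
    ∈-concat⁺ {xss = blocks} (there (there (there (here (∈-map⁺ f₃ (∈-others⁺ t∈ t≢a t≢b))))))
  degenerate⊆concat-blocks t∈ (there (there (there (here refl)))) = f₄∈ t∈

  solutions⊆concat-blocks : ∀ {v} → v ∈ solutions P h → v ∈ concat blocks
  solutions⊆concat-blocks {v} v∈ =
    let u , w , t , (_ , _ , t∈) , v∈deg , h≡′ =
          resolvent≡0⇒degenerate {P} {h} {v} (resolvent-pow-difference {h} a b h≡) v∈
        -- A degenerate solution might a priori leave another pair `u`, `w` with the same power
        -- differences; `a≢b` excludes this.
        u≡a , w≡b = pow-difference-injective a≢b (λ j → trans (sym (h≡′ j)) (h≡ j))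
    in degenerate⊆concat-blocks t∈ (subst₂ (λ u w → v ∈ degenerate u w t) u≡a w≡b v∈deg)

  count : S₂ P h ≡ 4 * P ∸ 4
  count = begin
    S₂ P h
      ≡⟨ sameMembers⇒length-≡ (solutions-unique P h) concat-blocks-unique
           solutions⊆concat-blocks concat-blocks⊆solutions ⟩
    length (concat blocks)
      ≡⟨ length-concat₄ (map f₁ (range P)) (map f₄ (range P)) (map f₂ others) (map f₃ others) ⟩
    length (map f₁ (range P)) + (length (map f₄ (range P)) + (length (map f₂ others) + length (map f₃ others)))
      ≡⟨ cong₂ _+_ (length-map-range f₁) (cong₂ _+_ (length-map-range f₄)
           (cong₂ _+_ (length-map f₂ others) (length-map f₃ others))) ⟩
    P + (P + (T + T))
      ≡⟨ cong (λ P → P + (P + (T + T))) 2+length-others≡P ⟨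
    2 + T + (2 + T + (T + T))
      ≡⟨ m+n∸m≡n 4 _ ⟨
    4 + (2 + T + (2 + T + (T + T))) ∸ 4
      ≡⟨ cong (_∸ 4) (collect T) ⟩
    4 * (2 + T) ∸ 4
      ≡⟨ cong (λ P → 4 * P ∸ 4) 2+length-others≡P ⟩
    4 * P ∸ 4 ∎
    where
    open ≡-Reasoning
    T = length others
    length-map-range : ∀ (f : ℤ → Quadruple) → length (map f (range P)) ≡ P
    length-map-range f = trans (length-map f (range P)) (length-range P)
    collect : ∀ T → 4 + (2 + T + (2 + T + (T + T))) ≡ 4 * (2 + T)
    collect = solve-∀

-- The exact count under condition (b)

module ConditionBCount {P : ℕ} {h : Vec ℤ 3} (h≡0 : ConditionB h) where

  offDiagonal : List (ℤ × ℤ)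
  offDiagonal = filter (λ (x , y) → ¬? (x ℤ.≟ y)) (cartesianProduct (range P) (range P))

  ∈-offDiagonal⁻ : ∀ {x y} → (x , y) ∈ offDiagonal → x ∈ range P × y ∈ range P × x ≢ y
  ∈-offDiagonal⁻ xy∈ =
    let xy∈range² , x≢y = ∈-filter⁻ (λ (x , y) → ¬? (x ℤ.≟ y))
                            {xs = cartesianProduct (range P) (range P)} xy∈
        x∈ , y∈ = ∈-cartesianProduct⁻ (range P) (range P) xy∈range²
    in x∈ , y∈ , x≢y

  ∈-offDiagonal⁺ : ∀ {x y} → x ∈ range P → y ∈ range P → x ≢ y → (x , y) ∈ offDiagonal
  ∈-offDiagonal⁺ x∈ y∈ = ∈-filter⁺ (λ (x , y) → ¬? (x ℤ.≟ y)) (∈-cartesianProduct⁺ x∈ y∈)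

  range²-unique : Unique (cartesianProduct (range P) (range P))
  range²-unique = Unique.cartesianProduct⁺ (range-unique P) (range-unique P)

  offDiagonal-unique : Unique offDiagonal
  offDiagonal-unique = Unique.filter⁺ _ range²-unique

  length-range² : length (cartesianProduct (range P) (range P)) ≡ P * P
  length-range² = trans (length-cartesianProductWith _,_ (range P) (range P))
    (cong₂ _*_ (length-range P) (length-range P))

  length-offDiagonal : P + length offDiagonal ≡ P * P
  length-offDiagonal = begin
    P + length offDiagonal
      ≡⟨ cong (λ n → n + length offDiagonal) (length-range P) ⟨
    length (range P) + length offDiagonal
      ≡⟨ cong (λ n → n + length offDiagonal) (length-map diagonal (range P)) ⟨
    length (map diagonal (range P)) + length offDiagonal
      ≡⟨ length-++ (map diagonal (range P)) ⟨
    length (map diagonal (range P) ++ offDiagonal)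
      ≡⟨ sameMembers⇒length-≡
           (Unique.++⁺ (Unique.map⁺ (cong proj₁) (range-unique P)) offDiagonal-unique disjoint-offDiagonal)
           range²-unique into onto ⟩
    length (cartesianProduct (range P) (range P))
      ≡⟨ length-range² ⟩
    P * P ∎
    where
    open ≡-Reasoning
    diagonal : ℤ → ℤ × ℤ
    diagonal x = x , x

    disjoint-offDiagonal : Disjoint (map diagonal (range P)) offDiagonal
    disjoint-offDiagonal (v∈diagonal , v∈off) with _ , _ , refl ← ∈-map⁻ diagonal v∈diagonal =
      proj₂ (proj₂ (∈-offDiagonal⁻ v∈off)) refl

    into : ∀ {v} → v ∈ map diagonal (range P) ++ offDiagonal → v ∈ cartesianProduct (range P) (range P)
    into v∈ with ∈-++⁻ (map diagonal (range P)) v∈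
    ... | inj₁ v∈diagonal with _ , x∈ , refl ← ∈-map⁻ diagonal v∈diagonal = ∈-cartesianProduct⁺ x∈ x∈
    ... | inj₂ v∈off = let x∈ , y∈ , _ = ∈-offDiagonal⁻ v∈off in ∈-cartesianProduct⁺ x∈ y∈

    onto : ∀ {v} → v ∈ cartesianProduct (range P) (range P) → v ∈ map diagonal (range P) ++ offDiagonal
    onto {x , y} v∈ with x ℤ.≟ y | ∈-cartesianProduct⁻ (range P) (range P) v∈
    ... | yes refl | x∈ , _  = ∈-++⁺ˡ (∈-map⁺ diagonal x∈)
    ... | no x≢y   | x∈ , y∈ = ∈-++⁺ʳ (map diagonal (range P)) (∈-offDiagonal⁺ x∈ y∈ x≢y)

  -- The two ways of matching {x₁, x₂} with {y₁, y₂}. They agree exactly when x = y, so `crossed` is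
  -- later applied off the diagonal only, for a total of P² + (P² - P).
  parallel crossed : ℤ × ℤ → Quadruple
  parallel (x , y) = x , y , x , y
  crossed  (x , y) = x , y , y , x

  parallels pairings : List Quadruple
  parallels = map parallel (cartesianProduct (range P) (range P))
  pairings  = parallels ++ map crossed offDiagonal

  pairings-unique : Unique pairings
  pairings-unique = Unique.++⁺
    (Unique.map⁺ (cong (λ (x₁ , x₂ , _) → x₁ , x₂)) range²-unique)
    (Unique.map⁺ (cong (λ (x₁ , x₂ , _) → x₁ , x₂)) offDiagonal-unique)
    (map-Disjoint (λ _ xy∈ eq → proj₂ (proj₂ (∈-offDiagonal⁻ xy∈))
      (trans (sym (cong proj₁ eq)) (cong (proj₁ ∘ proj₂ ∘ proj₂) eq))))

  -- Presents h = 0 as the degenerate case w = u, for any `u`, so that the lemmas on degenerate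
  -- quadruples apply.
  pow-self-difference : ∀ u j → lookup h j ≡ pow u j ℤ.- pow u j
  pow-self-difference u j = trans (h≡0 j) (sym (ℤ.i≡j⇒i-j≡0 {pow u j} refl))

  pairings⊆solutions : ∀ {v} → v ∈ pairings → v ∈ solutions P h
  pairings⊆solutions v∈ with ∈-++⁻ parallels v∈
  ... | inj₁ v∈parallels with (x , y) , xy∈ , refl ← ∈-map⁻ parallel v∈parallels =
    let x∈ , y∈ = ∈-cartesianProduct⁻ (range P) (range P) xy∈
    in degenerate⊆solutions {h = h} x∈ x∈ y∈ (pow-self-difference x) (here refl)
  ... | inj₂ v∈crossed with (x , y) , xy∈ , refl ← ∈-map⁻ crossed v∈crossed =
    let x∈ , y∈ , _ = ∈-offDiagonal⁻ xy∈
    in degenerate⊆solutions {h = h} x∈ x∈ y∈ (pow-self-difference x) (there (here refl))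

  parallel∈ : ∀ {x y} → x ∈ range P → y ∈ range P → parallel (x , y) ∈ pairings
  parallel∈ x∈ y∈ = ∈-++⁺ˡ (∈-map⁺ parallel (∈-cartesianProduct⁺ x∈ y∈))

  crossed∈ : ∀ {x y} → x ∈ range P → y ∈ range P → crossed (x , y) ∈ pairings
  crossed∈ {x} {y} x∈ y∈ with x ℤ.≟ y
  ... | yes refl = parallel∈ x∈ x∈
  ... | no x≢y   = ∈-++⁺ʳ parallels (∈-map⁺ crossed (∈-offDiagonal⁺ x∈ y∈ x≢y))

  degenerate⊆pairings : ∀ {u t v} → u ∈ range P → t ∈ range P → v ∈ degenerate u u t → v ∈ pairings
  degenerate⊆pairings u∈ t∈ (here refl)                         = parallel∈ u∈ t∈
  degenerate⊆pairings u∈ t∈ (there (here refl))                 = crossed∈ u∈ t∈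
  degenerate⊆pairings u∈ t∈ (there (there (here refl)))         = crossed∈ t∈ u∈
  degenerate⊆pairings u∈ t∈ (there (there (there (here refl)))) = parallel∈ t∈ u∈

  solutions⊆pairings : ∀ {v} → v ∈ solutions P h → v ∈ pairings
  solutions⊆pairings {v} v∈ =
    let u , w , t , (u∈ , _ , t∈) , v∈deg , h≡ =
          resolvent≡0⇒degenerate {P} {h} {v} (resolvent-pow-difference {h} 1ℤ 1ℤ (pow-self-difference 1ℤ)) v∈
        u≡w = begin
          u        ≡⟨ ℤ.^-identityʳ u ⟨
          u ℤ.^ 1  ≡⟨ ℤ.i-j≡0⇒i≡j (u ℤ.^ 1) (w ℤ.^ 1) (trans (sym (h≡ zero)) (h≡0 zero)) ⟩
          w ℤ.^ 1  ≡⟨ ℤ.^-identityʳ w ⟩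
          w        ∎
    in degenerate⊆pairings u∈ t∈ (subst (λ w → v ∈ degenerate u w t) (sym u≡w) v∈deg)
    where open ≡-Reasoning

  count : S₂ P h ≡ 2 * P ^ 2 ∸ P
  count = begin
    S₂ P h
      ≡⟨ sameMembers⇒length-≡ (solutions-unique P h) pairings-unique solutions⊆pairings pairings⊆solutions ⟩
    length pairings
      ≡⟨ length-++ parallels ⟩
    length parallels + length (map crossed offDiagonal)
      ≡⟨ cong₂ _+_ (trans (length-map parallel (cartesianProduct (range P) (range P))) length-range²)
                   (length-map crossed offDiagonal) ⟩
    P * P + length offDiagonal
      ≡⟨ m+n∸m≡n P _ ⟨
    P + (P * P + length offDiagonal) ∸ P
      ≡⟨ cong (_∸ P) (x+[y+z]≡y+[x+z] P (P * P) (length offDiagonal)) ⟩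
    P * P + (P + length offDiagonal) ∸ P
      ≡⟨ cong (λ n → P * P + n ∸ P) length-offDiagonal ⟩
    P * P + P * P ∸ P
      ≡⟨ cong (_∸ P) (2P²≡ P) ⟨
    2 * P ^ 2 ∸ P ∎
    where
    open ≡-Reasoning
    x+[y+z]≡y+[x+z] : ∀ x y z → x + (y + z) ≡ y + (x + z)
    x+[y+z]≡y+[x+z] = solve-∀
    2P²≡ : ∀ P → 2 * (P * (P * 1)) ≡ P * P + P * P
    2P²≡ = solve-∀

-- A vanishing resolvent alone does not place `h` in either class: (0, 0, h₃) has resolvent 0 for
-- every h₃. The solution `v` supplies `u` and `w` in the range with hⱼ = uʲ - wʲ, and whether they
-- coincide decides the class.
resolvent≡0⇒A⊎B : ∀ {P h v} → resolvent h ≡ 0ℤ → v ∈ solutions P h →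
  (ConditionA P h × S₂ P h ≡ 4 * P ∸ 4) ⊎ (ConditionB h × S₂ P h ≡ 2 * P ^ 2 ∸ P)
resolvent≡0⇒A⊎B {P} {h} {v} resolvent≡0 v∈ = classify (resolvent≡0⇒degenerate {P} {h} {v} resolvent≡0 v∈)
  where
  classify : Degenerate P h v →
    (ConditionA P h × S₂ P h ≡ 4 * P ∸ 4) ⊎ (ConditionB h × S₂ P h ≡ 2 * P ^ 2 ∸ P)
  classify (u , w , _ , (u∈ , w∈ , _) , _ , h≡) with u ℤ.≟ w
  ... | no u≢w   = inj₁ ((u , w , u≢w , ∈-range⁻ u∈ , ∈-range⁻ w∈ , h≡) , ConditionACount.count {P} {h} u≢w u∈ w∈ h≡)
  ... | yes u≡w = inj₂ (h≡0 , ConditionBCount.count {P} {h} h≡0)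
    where
    h≡0 : ConditionB h
    h≡0 j = trans (h≡ j) (ℤ.i≡j⇒i-j≡0 (cong (λ u → pow u j) u≡w))

-- Nondegenerate solutions

∣difference∣≤ : ∀ {P x y} → x ∈ range P → y ∈ range P → ∣ x ℤ.- y ∣ ≤ P
∣difference∣≤ {P} x∈ y∈
  with i , i∈ , refl ← ∈-map⁻ (+_ ∘ suc) x∈
     | j , j∈ , refl ← ∈-map⁻ (+_ ∘ suc) y∈ =
  ≤-trans (ℤ.∣m⊝n∣≤m⊔n (suc i) (suc j)) (⊔-lub (∈-upTo⁻ i∈) (∈-upTo⁻ j∈))

∣rootProduct∣ : ∀ x₁ x₂ y₁ y₂ → ∣ rootProduct (x₁ , x₂ , y₁ , y₂) ∣ ≡
  ∣ x₁ ℤ.- y₁ ∣ * ∣ x₁ ℤ.- y₂ ∣ * ∣ x₂ ℤ.- y₁ ∣ * ∣ x₂ ℤ.- y₂ ∣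
∣rootProduct∣ x₁ x₂ y₁ y₂ =
  trans (ℤ.abs-* (d₁₁ ℤ.* d₁₂ ℤ.* d₂₁) d₂₂)
    (cong (_* ∣ d₂₂ ∣) (trans (ℤ.abs-* (d₁₁ ℤ.* d₁₂) d₂₁) (cong (_* ∣ d₂₁ ∣) (ℤ.abs-* d₁₁ d₁₂))))
  where
  d₁₁ = x₁ ℤ.- y₁
  d₁₂ = x₁ ℤ.- y₂
  d₂₁ = x₂ ℤ.- y₁
  d₂₂ = x₂ ℤ.- y₂

∣rootProduct∣≤P^4 : ∀ {P v} → v ∈ quadruples P → ∣ rootProduct v ∣ ≤ P ^ 4
∣rootProduct∣≤P^4 {P} {x₁ , x₂ , y₁ , y₂} v∈ =
  let x₁∈ , x₂∈ , y₁∈ , y₂∈ = ∈-quadruples⁻ {P} v∈ in begin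
  ∣ rootProduct (x₁ , x₂ , y₁ , y₂) ∣
    ≡⟨ ∣rootProduct∣ x₁ x₂ y₁ y₂ ⟩
  ∣ x₁ ℤ.- y₁ ∣ * ∣ x₁ ℤ.- y₂ ∣ * ∣ x₂ ℤ.- y₁ ∣ * ∣ x₂ ℤ.- y₂ ∣
    ≤⟨ *-mono-≤ (*-mono-≤ (*-mono-≤ (∣difference∣≤ {P} x₁∈ y₁∈) (∣difference∣≤ {P} x₁∈ y₂∈))
                          (∣difference∣≤ {P} x₂∈ y₁∈)) (∣difference∣≤ {P} x₂∈ y₂∈) ⟩
  P * P * P * P
    ≡⟨ P⁴≡ P ⟩
  P ^ 4 ∎
  where
  open ≤-Reasoning
  P⁴≡ : ∀ P → P * P * P * P ≡ P * (P * (P * (P * 1)))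
  P⁴≡ = solve-∀

differences-divide : ∀ x₁ x₂ y₁ y₂ → let D = rootProduct (x₁ , x₂ , y₁ , y₂) in
  (x₁ ℤ.- y₁) ∣ℤ D × (x₁ ℤ.- y₂) ∣ℤ D × (x₂ ℤ.- y₁) ∣ℤ D
differences-divide x₁ x₂ y₁ y₂ rewrite ∣rootProduct∣ x₁ x₂ y₁ y₂ =
    ∣m⇒∣m*n d₂₂ (∣m⇒∣m*n d₂₁ (m∣m*n d₁₂))
  , ∣m⇒∣m*n d₂₂ (∣m⇒∣m*n d₂₁ (n∣m*n d₁₁))
  , ∣m⇒∣m*n d₂₂ (n∣m*n (d₁₁ * d₁₂))
  where
  d₁₁ = ∣ x₁ ℤ.- y₁ ∣
  d₁₂ = ∣ x₁ ℤ.- y₂ ∣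
  d₂₁ = ∣ x₂ ℤ.- y₁ ∣
  d₂₂ = ∣ x₂ ℤ.- y₂ ∣

signed : List ℕ → List ℤ
signed ns = map +_ ns ++ map (ℤ.-_ ∘ +_) ns

∈-signed : ∀ {ns} i → ∣ i ∣ ∈ ns → i ∈ signed ns
∈-signed           (+ n)      n∈ = ∈-++⁺ˡ (∈-map⁺ +_ n∈)
∈-signed {ns} ℤ.-[1+ n ] n∈ = ∈-++⁺ʳ (map +_ ns) (∈-map⁺ (ℤ.-_ ∘ +_) n∈)

length-signed : ∀ ns → length (signed ns) ≡ 2 * length ns
length-signed ns = begin
  length (signed ns)
    ≡⟨ length-++ (map +_ ns) ⟩
  length (map +_ ns) + length (map (ℤ.-_ ∘ +_) ns)
    ≡⟨ cong₂ _+_ (length-map +_ ns) (length-map (ℤ.-_ ∘ +_) ns) ⟩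
  length ns + length ns
    ≡⟨ cong (_+_ (length ns)) (+-identityʳ (length ns)) ⟨
  2 * length ns ∎
  where open ≡-Reasoning

-- The solution `v` is a reference point: `rootProduct` has the same value at all solutions, since
-- 12 times it is `resolvent h`. One list of divisors therefore covers the differences of all of
-- them, and each difference has two possible signs.
S₂≤divisors³ : ∀ {P h v ds} → resolvent h ≢ 0ℤ → v ∈ solutions P h →
  (∀ {d} → d ∣ ∣ rootProduct v ∣ → d ∈ ds) → S₂ P h ≤ (2 * length ds) ^ 3
S₂≤divisors³ {P} {h} {v} {ds} resolvent≢0 v∈ complete = begin
  S₂ P h
    ≤⟨ injection⇒length-≤ differences (solutions-unique P h)
         (λ {v₁} {v₂} v₁∈ v₂∈ → differences-injective {h} {v₁} {v₂} resolvent≢0 (solution v₁∈) (solution v₂∈))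
         (λ {v′} → differences∈ {v′}) ⟩
  length triples
    ≡⟨ length-cartesianProductWith _,_ (signed ds) (cartesianProduct (signed ds) (signed ds)) ⟩
  length (signed ds) * length (cartesianProduct (signed ds) (signed ds))
    ≡⟨ cong (length (signed ds) *_) (length-cartesianProductWith _,_ (signed ds) (signed ds)) ⟩
  length (signed ds) * (length (signed ds) * length (signed ds))
    ≡⟨ cong (λ l → l * (l * l)) (length-signed ds) ⟩
  2 * length ds * (2 * length ds * (2 * length ds))
    ≡⟨ cong (λ l → 2 * length ds * (2 * length ds * l)) (*-identityʳ (2 * length ds)) ⟨
  (2 * length ds) ^ 3 ∎
  where
  open ≤-Reasoning

  solution : ∀ {v} → v ∈ solutions P h → IsSolution h v
  solution v∈ = proj₂ (∈-solutions⁻ {P} {h} v∈)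

  triples : List (ℤ × ℤ × ℤ)
  triples = cartesianProduct (signed ds) (cartesianProduct (signed ds) (signed ds))

  rootProduct-constant : ∀ {v′} → v′ ∈ solutions P h → rootProduct v′ ≡ rootProduct v
  rootProduct-constant {v′} v′∈ = ℤ.*-cancelˡ-≡ (+ 12) (rootProduct v′) (rootProduct v)
    (trans (12*rootProduct≡resolvent {h} {v′} (solution v′∈))
           (sym (12*rootProduct≡resolvent {h} {v} (solution v∈))))

  differences∈ : ∀ {v′} → v′ ∈ solutions P h → differences v′ ∈ triples
  differences∈ {x₁ , x₂ , y₁ , y₂} v′∈ =
    let d₁₁∣ , d₁₂∣ , d₂₁∣ = differences-divide x₁ x₂ y₁ y₂
    in ∈-cartesianProduct⁺ (member (x₁ ℤ.- y₁) d₁₁∣)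
         (∈-cartesianProduct⁺ (member (x₁ ℤ.- y₂) d₁₂∣) (member (x₂ ℤ.- y₁) d₂₁∣))
    where
    member : ∀ i → i ∣ℤ rootProduct (x₁ , x₂ , y₁ , y₂) → i ∈ signed ds
    member i i∣ = ∈-signed i (complete (subst (i ∣ℤ_) (rootProduct-constant v′∈) i∣))

n≤n^4 : ∀ n → n ≤ n ^ 4
n≤n^4 zero      = z≤n
n≤n^4 n@(suc _) = m≤m*n n (n ^ 3) {{m^n≢0 n 3}}

length≡0⊎∈ : ∀ {A : Set} (xs : List A) → length xs ≡ 0 ⊎ ∃ (_∈ xs)
length≡0⊎∈ []      = inj₁ refl
length≡0⊎∈ (x ∷ _) = inj₂ (x , here refl)

resolvent≢0⇒S₂-bound : ∀ m .{{_ : NonZero m}} →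
  ∃ λ C → ∀ P h → resolvent h ≢ 0ℤ → S₂ P h ^ m ≤ suc C * P
resolvent≢0⇒S₂-bound m = C , bound
  where
  instance
    12m≢0 : NonZero (3 * (m * 4))
    12m≢0 = m*n≢0 3 (m * 4) {{_}} {{m*n≢0 m 4}}

  -- The exponent 3 · 4 · m: three differences determine a solution, and the integer they divide may
  -- be as large as P⁴.
  K = proj₁ (divisor-bound (3 * (m * 4)))
  C = 2 ^ (3 * (m * 4)) * K

  bound : ∀ P h → resolvent h ≢ 0ℤ → S₂ P h ^ m ≤ suc C * P
  -- As `h` is arbitrary, `resolvent h` has no bound in terms of `P` until a solution is at hand;
  -- hence the case distinction.
  bound P h resolvent≢0 = [ no-solution , (λ (v , v∈) → some-solution v v∈) ]′ (length≡0⊎∈ (solutions P h))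
    where
    open ≤-Reasoning

    no-solution : S₂ P h ≡ 0 → S₂ P h ^ m ≤ suc C * P
    no-solution S≡0 = begin
      S₂ P h ^ m ≡⟨ cong (_^ m) S≡0 ⟩
      0 ^ m      ≡⟨ 0^n≡0 m ⟩
      0          ≤⟨ z≤n ⟩
      suc C * P  ∎
      where
      0^n≡0 : ∀ n .{{_ : NonZero n}} → 0 ^ n ≡ 0
      0^n≡0 (suc _) = refl

    some-solution : ∀ v → v ∈ solutions P h → S₂ P h ^ m ≤ suc C * P
    -- Passing to `suc C` makes the constant visibly nonzero, as `bound-^` requires.
    some-solution v v∈ = ≤-trans (^-cancelˡ-≤ 4 S^4m≤) (*-monoˡ-≤ P (n≤1+n C))
      where
      instance
        rootProduct≢0 : NonZero ∣ rootProduct v ∣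
        rootProduct≢0 = ℤ.≢-nonZero λ product≡0 → resolvent≢0
          (trans (sym (12*rootProduct≡resolvent {h} {v} (proj₂ (∈-solutions⁻ {P} {h} v∈))))
                 (cong (+ 12 ℤ.*_) product≡0))

      cover = proj₂ (divisor-bound (3 * (m * 4))) ∣ rootProduct v ∣
      ds = proj₁ cover

      S^4m≤ : (S₂ P h ^ m) ^ 4 ≤ (C * P) ^ 4
      S^4m≤ = begin
        (S₂ P h ^ m) ^ 4
          ≡⟨ ^-*-assoc (S₂ P h) m 4 ⟩
        S₂ P h ^ (m * 4)
          ≤⟨ ^-monoˡ-≤ (m * 4) (S₂≤divisors³ {P} {h} {v} resolvent≢0 v∈ (proj₁ (proj₂ cover))) ⟩
        ((2 * length ds) ^ 3) ^ (m * 4)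
          ≡⟨ ^-*-assoc (2 * length ds) 3 (m * 4) ⟩
        (2 * length ds) ^ (3 * (m * 4))
          ≡⟨ ^-distribʳ-* (3 * (m * 4)) 2 (length ds) ⟩
        2 ^ (3 * (m * 4)) * length ds ^ (3 * (m * 4))
          ≤⟨ *-monoʳ-≤ (2 ^ (3 * (m * 4))) (proj₂ (proj₂ cover)) ⟩
        2 ^ (3 * (m * 4)) * (K * ∣ rootProduct v ∣)
          ≡⟨ *-assoc (2 ^ (3 * (m * 4))) K ∣ rootProduct v ∣ ⟨
        C * ∣ rootProduct v ∣
          -- The constant is inflated to `C ^ 4` so that the right-hand side is a perfect fourth
          -- power and the root can be taken.
          ≤⟨ *-mono-≤ (n≤n^4 C) (∣rootProduct∣≤P^4 {P} {v} (proj₁ (∈-solutions⁻ {P} {h} v∈))) ⟩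
        C ^ 4 * P ^ 4
          ≡⟨ ^-distribʳ-* 4 C P ⟨
        (C * P) ^ 4 ∎

-- Real exponents

Lower<Upper : ∀ (θ : ℝ) {q r} → Lower θ q → Upper θ r → q ℚ.< r
Lower<Upper θ {q} {r} q∈ r∈ with ℚ.<-cmp q r
... | tri< q<r _ _  = q<r
... | tri≈ _ refl _ = contradiction (q∈ , r∈) (disjoint θ q)
... | tri> _ _ r<q  = contradiction (q∈ , Equivalence.from (upper-rounded θ q) (r , r<q , r∈)) (disjoint θ q)

-- Roundedness of the lower cut at 0 yields a positive rational (n+1)/(d+1) below θ. Every rational
-- above θ exceeds it, hence exceeds 1/(d+1); the conclusion is this comparison with denominators
-- cleared.
positive⇒unit-fraction-below : ∀ (θ : ℝ) → Lower θ 0ℚ →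
  ∃ λ d → ∀ p k → Upper θ (+ p ℚ./ suc k) → suc k ≤ p * suc d
positive⇒unit-fraction-below θ 0∈ with Equivalence.to (lower-rounded θ 0ℚ) 0∈
... | mkℚ (+ zero)     d _ , ℚ.*<* (ℤ.+<+ ()) , _
... | mkℚ (ℤ.-[1+ _ ]) d _ , ℚ.*<* () , _
... | r@(mkℚ (+ suc n)    d _) , _ , r∈ = d , below
  where
  below : ∀ p k → Upper θ (+ p ℚ./ suc k) → suc k ≤ p * suc d
  -- The division of rationals reduces to lowest terms, so the inequality is carried over to the
  -- unreduced fraction before cross-multiplying.
  below p k p/k∈ with ℚᵘ.<-respʳ-≃ (ℚ.toℚᵘ-fromℚᵘ (mkℚᵘ (+ p) k)) (ℚ.toℚᵘ-mono-< (Lower<Upper θ r∈ p/k∈))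
  ... | ℚᵘ.*<* n*k<p*d = ≤-trans (m≤n*m (suc k) (suc n))
    (<⇒≤ (ℤ.drop‿+<+ (subst₂ ℤ._<_ (sym (ℤ.pos-* (suc n) (suc k))) (sym (ℤ.pos-* p (suc d))) n*k<p*d)))

^-swap : ∀ n i j → (n ^ i) ^ j ≡ (n ^ j) ^ i
^-swap n i j = trans (^-*-assoc n i j) (trans (cong (n ^_) (*-comm i j)) (sym (^-*-assoc n j i)))

-- In real exponents: N > P^(p/(k+1)) ≥ P^(1/m) gives P² < N^(2m) ≤ C P, hence P < C. The chain
-- below is this argument raised to the power k+1.
large⇒P<C : ∀ {N C P p k m} .{{_ : NonZero P}} .{{_ : NonZero m}} → N ^ (m * 2) ≤ C * P →
  suc k ≤ p * m → P ^ p < N ^ suc k → P < C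
large⇒P<C {N} {C} {P} {p} {k} {m} N^2m≤ k<pm P^p<N^k = *-cancelʳ-< P P C (≰⇒> λ CP≤P² →
  <-irrefl refl (begin-strict
    (C * P) ^ suc k          ≤⟨ ^-monoˡ-≤ (suc k) CP≤P² ⟩
    (P * P) ^ suc k          ≡⟨ cong (λ n → (P * n) ^ suc k) (*-identityʳ P) ⟨
    (P ^ 2) ^ suc k          ≡⟨ ^-swap P 2 (suc k) ⟩
    (P ^ suc k) ^ 2          ≤⟨ ^-monoˡ-≤ 2 (^-monoʳ-≤ P k<pm) ⟩
    (P ^ (p * m)) ^ 2        ≡⟨ cong (_^ 2) (^-*-assoc P p m) ⟨
    ((P ^ p) ^ m) ^ 2        ≡⟨ ^-*-assoc (P ^ p) m 2 ⟩
    (P ^ p) ^ (m * 2)        <⟨ ^-monoˡ-< (m * 2) {{m*n≢0 m 2}} P^p<N^k ⟩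
    (N ^ suc k) ^ (m * 2)    ≡⟨ ^-swap N (suc k) (m * 2) ⟩
    (N ^ (m * 2)) ^ suc k    ≤⟨ ^-monoˡ-≤ (suc k) N^2m≤ ⟩
    (C * P) ^ suc k          ∎))
  where open ≤-Reasoning

-- In real exponents: N ≤ (C P)^(1/m) ≤ C P^(p/(k+1)), because C ≥ 1 and 1/m ≤ p/(k+1). Both sides
-- are compared through their `m`-th powers.
bound-^ : ∀ {N C P p k m} .{{_ : NonZero C}} .{{_ : NonZero P}} .{{_ : NonZero m}} → N ^ m ≤ C * P →
  suc k ≤ p * m → N ^ suc k ≤ C ^ suc k * P ^ p
bound-^ {N} {C} {P} {p} {k} {m} N^m≤ k<pm = ^-cancelˡ-≤ m (begin
  (N ^ suc k) ^ m                ≡⟨ ^-swap N (suc k) m ⟩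
  (N ^ m) ^ suc k                ≤⟨ ^-monoˡ-≤ (suc k) N^m≤ ⟩
  (C * P) ^ suc k                ≡⟨ ^-distribʳ-* (suc k) C P ⟩
  C ^ suc k * P ^ suc k          ≤⟨ *-mono-≤ (^-monoʳ-≤ C (m≤m*n (suc k) m)) (^-monoʳ-≤ P k<pm) ⟩
  C ^ (suc k * m) * P ^ (p * m)  ≡⟨ cong₂ _*_ (^-*-assoc C (suc k) m) (^-*-assoc P p m) ⟨
  (C ^ suc k) ^ m * (P ^ p) ^ m  ≡⟨ ^-distribʳ-* m (C ^ suc k) (P ^ p) ⟨
  (C ^ suc k * P ^ p) ^ m        ∎)
  where open ≤-Reasoning

theorem1p1 : (∀ (η : ℝ) → Lower η 0ℚ → Upper η 1ℚ →
    ∃ λ (P₀ : ℕ) → ∀ (P : ℕ) → P₀ ≤ P → 1 ≤ P → ∀ (h : Vec ℤ 3) →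
    S₂ P h > P ^ʳ η →
    (ConditionA P h × S₂ P h ≡ 4 * P ∸ 4)
    ⊎ (ConditionB h × S₂ P h ≡ 2 * P ^ 2 ∸ P))
    ×
    (∀ (ε : ℝ) → Lower ε 0ℚ →
    ∃ λ (C : ℕ) → ∀ (P : ℕ) → 1 ≤ P → ∀ (h : Vec ℤ 3) →
    ¬ ConditionA P h → ¬ ConditionB h → S₂ P h ≤ C · P ^ʳ ε)
theorem1p1 = many-solutions , few-solutions
  where
  many-solutions : ∀ (η : ℝ) → Lower η 0ℚ → Upper η 1ℚ →
    ∃ λ P₀ → ∀ P → P₀ ≤ P → 1 ≤ P → ∀ h → S₂ P h > P ^ʳ η →
    (ConditionA P h × S₂ P h ≡ 4 * P ∸ 4) ⊎ (ConditionB h × S₂ P h ≡ 2 * P ^ 2 ∸ P)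
  many-solutions η 0<η _ =
    let d , below = positive⇒unit-fraction-below η 0<η
        C , bound = resolvent≢0⇒S₂-bound (suc d * 2)
    -- The threshold equals the constant of the bound: a nonzero resolvent would give `P < suc C`,
    -- against `suc C ≤ P`.
    in suc C , λ where
      P C<P 1≤P h (p , k , p/k∈ , P^p<S^k) →
        let instance _ = >-nonZero 1≤P in
        case resolvent h ℤ.≟ 0ℤ of λ where
          (no resolvent≢0) → contradiction
            (large⇒P<C {S₂ P h} {p = p} {k} {suc d} (bound P h resolvent≢0) (below p k p/k∈) P^p<S^k)
            (≤⇒≯ C<P)
          (yes resolvent≡0) →
            [ (λ S≡0 → contradiction (subst (λ S → P ^ p < S ^ suc k) S≡0 P^p<S^k) (λ ()))
            , (λ (v , v∈) → resolvent≡0⇒A⊎B {P} {h} {v} resolvent≡0 v∈)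
            ]′ (length≡0⊎∈ (solutions P h))

  few-solutions : ∀ (ε : ℝ) → Lower ε 0ℚ →
    ∃ λ C → ∀ P → 1 ≤ P → ∀ h → ¬ ConditionA P h → ¬ ConditionB h → S₂ P h ≤ C · P ^ʳ ε
  few-solutions ε 0<ε =
    let d , below = positive⇒unit-fraction-below ε 0<ε
        C , bound = resolvent≢0⇒S₂-bound (suc d)
    in suc C , λ P 1≤P h ¬A ¬B p k p/k∈ →
        let instance _ = >-nonZero 1≤P in
        case resolvent h ℤ.≟ 0ℤ of λ where
          (no resolvent≢0) → bound-^ {S₂ P h} {p = p} {k} {suc d} (bound P h resolvent≢0) (below p k p/k∈)
          (yes resolvent≡0) →
            [ (λ S≡0 → subst (λ S → S ^ suc k ≤ suc C ^ suc k * P ^ p) (sym S≡0) z≤n)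
            , (λ (v , v∈) → [ (λ (A , _) → contradiction A ¬A) , (λ (B , _) → contradiction B ¬B) ]′
                (resolvent≡0⇒A⊎B {P} {h} {v} resolvent≡0 v∈))
            ]′ (length≡0⊎∈ (solutions P h))
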